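{- Let $G$ be a graph, let $k\ge 1$ be an integer, and let $j$ be an integer with $\mathsf{s}_j(G) > j \geq \gamma_P(G)$. Let $q$ and $r$ be the non-negative integers (given by the division algorithm) with $k+1=q(\mathsf{s}_j(G)-j+1)+r$ and $0\le r<\mathsf{s}_j(G)-j+1$. Then \[ \ddot{\gamma}_P^k(G) \leq \begin{cases} \mathsf{s}_j(G)\left(\frac{k+1}{\mathsf{s}_j(G)-j+1}\right) & \text{if } r=0,\\[4pt] \mathsf{s}_j(G)\left\lfloor \frac{k+1}{\mathsf{s}_j(G)-j+1}\right\rfloor + r+(j-1) & \text{if } r>0. \end{cases} \]
   Context: All graphs are finite, simple, undirected, with nonempty vertex set. For $S\subseteq V(G)$ the power domination process is: (1) start with the observed set $N[S]$ (the union of closed neighborhoods of vertices of $S$); (2) while some observed vertex has exactly one unobserved neighbor $w$, add $w$ to the observed set. $S$ is a power dominating set if eventually all vertices are observed. $\gamma_P(G)$ is the minimum cardinality of a power dominating set. For an integer $k\ge 0$, a multiset $S$ of vertices of $G$ (its elements are called PMUs) is a $k$-PMU-defect-robust power dominating set ($k$-rPDS) if $|S|\ge k$ and for every submultiset $F$ of $S$ with $|F|=k$, the underlying set of $S\setminus F$ (multiset difference) contains a power dominating set of $G$. Cardinalities of multisets count multiplicity. $\ddot{\gamma}_P^k(G)$ is the minimum cardinality of a $k$-rPDS of $G$. For an integer $j\ge\gamma_P(G)$, $\mathsf{s}_j(G)$ is the maximum cardinality of a set $B\subseteq V(G)$ such that every $A\subseteq B$ with $|A|=j$ is a power dominating set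 of $G$ (undefined if no such $B$ exists). -}

module Defs where

open import Data.Nat.Base
  using (ℕ; zero; suc; _∸_; _≤_; _<_; _≥_; z≤n; s≤s; NonZero; _<ᵇ_)
import Data.Nat.Properties as ℕ
open import Data.Fin.Base using (Fin; zero; suc)
import Data.Fin.Properties as Fin
open import Data.Fin.Subset using (Subset; _∈_; _∉_; _⊆_; _⊃_; _∪_; ⁅_⁆; ⊤; ⊥; ∣_∣; inside)
open import Data.Fin.Subset.Properties
open import Data.Fin.Subset.Induction using (⊃-wellFounded; Acc; acc)
open import Data.Vec.Base using (Vec; []; _∷_; map; zipWith; sum; replicate; tabulate)
open import Data.Vec.Properties using (lookup∘tabulate; lookup⇒[]=; []=⇒lookup)
open import Data.Vec.Relation.Binary.Pointwise.Inductive as Pointwise using (Pointwise; []; _∷_)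
open import Data.Product.Base using (∃; ∃-syntax; _×_; _,_; proj₁; proj₂)
open import Data.Sum.Base using (_⊎_; inj₁; inj₂)
open import Level using (0ℓ)
open import Relation.Binary.Construct.Closure.ReflexiveTransitive using (Star; ε; _◅_; _◅◅_)
open import Relation.Binary.PropositionalEquality
  using (_≡_; refl; sym; trans; cong; subst)
open import Relation.Nullary
  using (¬_; Dec; yes; no; does; contradiction; ¬?; map′; _×-dec_; _⊎-dec_; _→-dec_)
open import Relation.Nullary.Decidable using (dec-true; decidable-stable)
open import Relation.Unary using (Pred; Decidable)

IsLeast : Pred ℕ 0ℓ → Pred ℕ 0ℓ
IsLeast P m = P m × (∀ {x} → P x → m ≤ x)

IsGreatest : Pred ℕ 0ℓ → Pred ℕ 0ℓ
IsGreatest P m = P m × (∀ {x} → P x → x ≤ m)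

abstract
  least : {P : Pred ℕ 0ℓ} → Decidable P → ∃ P → ∃ (IsLeast P)
  least P? (m , Pm) = go P? m Pm
    where
    go : {P : Pred ℕ 0ℓ} → Decidable P → ∀ m → P m → ∃ (IsLeast P)
    go P? zero    Pm = zero , Pm , λ _ → z≤n
    go {P} P? (suc m) Pm with P? zero
    ... | yes P0 = zero , P0 , λ _ → z≤n
    ... | no ¬P0 with go (λ x → P? (suc x)) m Pm
    ...   | l , Pl , l≤ = suc l , Pl , bound
      where
      bound : ∀ {x} → P x → suc l ≤ x
      bound {zero}  P0 = contradiction P0 ¬P0
      bound {suc x} Px = s≤s (l≤ Px)

  greatest : {P : Pred ℕ 0ℓ} → Decidable P → ∃ P →
             ∀ b → (∀ {x} → P x → x ≤ b) → ∃ (IsGreatest P)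
  greatest P? (m , Pm) zero ub with ub Pm
  ... | z≤n = zero , Pm , ub
  greatest {P} P? ∃P (suc b) ub with P? (suc b)
  ... | yes Pb = suc b , Pb , ub
  ... | no ¬Pb = greatest P? ∃P b ub′
    where
    ub′ : ∀ {x} → P x → x ≤ b
    ub′ Px = ℕ.≤-pred (ℕ.≤∧≢⇒< (ub Px) λ { refl → ¬Pb Px })

-- Decidability of adjacency costs nothing for finite graphs classically.
record Graph : Set₁ where
  infix 4 _~_ _~?_
  field
    order    : ℕ
    nonEmpty : NonZero order
    _~_      : Fin order → Fin order → Set
    _~?_     : ∀ v w → Dec (v ~ w)
    ~-sym    : ∀ {v w} → v ~ w → w ~ v
    ~-irrefl : ∀ {v} → ¬ (v ~ v)

module _ (G : Graph) where
  open Graph G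

  dominated? : ∀ S w → Dec (∃[ v ] v ∈ S × (v ≡ w ⊎ v ~ w))
  dominated? S w = Fin.any? λ v → v ∈? S ×-dec (v Fin.≟ w ⊎-dec v ~? w)

  N[_] : Subset order → Subset order
  N[ S ] = tabulate λ w → does (dominated? S w)

  data Forces (O : Subset order) : Subset order → Set where
    force : ∀ {v w} → v ∈ O → v ~ w → w ∉ O →
            (∀ u → v ~ u → u ∉ O → u ≡ w) →
            Forces O (O ∪ ⁅ w ⁆)

  -- The outcome of the process does not depend on the order of the steps (see
  -- absorb below), so it is enough that some run observes every vertex.
  IsPDS : Pred (Subset order) 0ℓ
  IsPDS S = Star Forces N[ S ] ⊤

-- A multiset of vertices is encoded by the vector of its multiplicities.
Multiset : ℕ → Set
Multiset n = Vec ℕ n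

infix 4 _⊑_
_⊑_ : ∀ {n} → Multiset n → Multiset n → Set
_⊑_ = Pointwise _≤_

infixl 6 _∖_
_∖_ : ∀ {n} → Multiset n → Multiset n → Multiset n
_∖_ = zipWith _∸_

card : ∀ {n} → Multiset n → ℕ
card = sum

support : ∀ {n} → Multiset n → Subset n
support = map (0 <ᵇ_)

IsRobustPDS : (G : Graph) → ℕ → Pred (Multiset (Graph.order G)) 0ℓ
IsRobustPDS G k S =
  card S ≥ k ×
  (∀ F → F ⊑ S → card F ≡ k → ∃[ D ] D ⊆ support (S ∖ F) × IsPDS G D)

module _ (G : Graph) where
  open Graph G

  PDSOfSize : Pred ℕ 0ℓ
  PDSOfSize m = ∃[ S ] ∣ S ∣ ≡ m × IsPDS G S

  RobustPDSOfSize : ℕ → Pred ℕ 0ℓ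
  RobustPDSOfSize k m = ∃[ S ] card S ≡ m × IsRobustPDS G k S

  EverySubsetPDS : ℕ → Pred (Subset order) 0ℓ
  EverySubsetPDS j B = ∀ A → A ⊆ B → ∣ A ∣ ≡ j → IsPDS G A

  EverySubsetPDSOfSize : ℕ → Pred ℕ 0ℓ
  EverySubsetPDSOfSize j m = ∃[ B ] ∣ B ∣ ≡ m × EverySubsetPDS j B

-- What follows, up to minPDS, only serves to show that the minima and the maximum
-- exist constructively, so that γP, γ̈P and s are actual numbers.

private
  module Pow (G : Graph) where
    open Graph G

    N⁺ : ∀ {S v w} → v ∈ S → v ≡ w ⊎ v ~ w → w ∈ N[_] G S
    N⁺ {S} {w = w} v∈S vw =
      lookup⇒[]= w _ (trans (lookup∘tabulate _ w) (dec-true (dominated? G S w) (_ , v∈S , vw)))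

    N⁻ : ∀ {S w} → w ∈ N[_] G S → ∃[ v ] v ∈ S × (v ≡ w ⊎ v ~ w)
    N⁻ {S} {w} w∈N = extract (dominated? G S w) (trans (sym (lookup∘tabulate _ w)) ([]=⇒lookup w∈N))
      where
      extract : ∀ {A : Set} (a? : Dec A) → does a? ≡ inside → A
      extract (yes a) _ = a
      extract (no _) ()

    CanForce : Pred (Subset order) 0ℓ
    CanForce O = ∃[ v ] ∃[ w ] v ∈ O × v ~ w × w ∉ O × (∀ u → v ~ u → u ∉ O → u ≡ w)

    canForce? : Decidable CanForce
    canForce? O = Fin.any? λ v → Fin.any? λ w →
      v ∈? O ×-dec v ~? w ×-dec ¬? (w ∈? O) ×-dec
      Fin.all? λ u → v ~? u →-dec ¬? (u ∈? O) →-dec u Fin.≟ w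

    saturate : ∀ O → Acc _⊃_ O → ∃[ O′ ] Star (Forces G) O O′ × ¬ CanForce O′
    saturate O (acc rs) with canForce? O
    ... | no stuck = O , ε , stuck
    ... | yes (v , w , v∈O , v~w , w∉O , only)
      with saturate (O ∪ ⁅ w ⁆)
             (rs (p⊆p∪q ⁅ w ⁆ , w , q⊆p∪q O ⁅ w ⁆ (x∈⁅x⁆ w) , w∉O))
    ...   | O′ , steps , stuck = O′ , force v∈O v~w w∉O only ◅ steps , stuck

    absorb : ∀ {O P O′} → Star (Forces G) O P → O ⊆ O′ → ¬ CanForce O′ → P ⊆ O′
    absorb ε O⊆ stuck = O⊆
    absorb {O} {O′ = O′} (force {v} {w} v∈O v~w w∉O only ◅ steps) O⊆ stuck =
      absorb steps O∪w⊆ stuck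
      where
      w∈O′ : w ∈ O′
      w∈O′ = decidable-stable (w ∈? O′) λ w∉O′ → stuck
        (v , w , O⊆ v∈O , v~w , w∉O′ , λ u v~u u∉O′ → only u v~u λ u∈O → u∉O′ (O⊆ u∈O))
      O∪w⊆ : O ∪ ⁅ w ⁆ ⊆ O′
      O∪w⊆ x∈ with x∈p∪q⁻ O ⁅ w ⁆ x∈
      ... | inj₁ x∈O = O⊆ x∈O
      ... | inj₂ x∈w = subst (_∈ O′) (sym (x∈⁅y⁆⇒x≡y w x∈w)) w∈O′

    extends : ∀ {O O′} → Star (Forces G) O O′ → O ⊆ O′
    extends ε x∈O = x∈O
    extends (force {w = w} _ _ _ _ ◅ steps) x∈O = extends steps (p⊆p∪q ⁅ w ⁆ x∈O)

    isPDS? : Decidable (IsPDS G)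
    isPDS? S with saturate (N[_] G S) (⊃-wellFounded _)
    ... | O′ , steps , stuck with ⊤ ⊆? O′
    ...   | yes ⊤⊆ = yes (subst (Star (Forces G) _) (⊆-antisym ⊆⊤ ⊤⊆) steps)
    ...   | no  ⊤⊈ = no λ pds → ⊤⊈ (absorb pds (extends steps) stuck)

    ⊤-isPDS : IsPDS G ⊤
    ⊤-isPDS = subst (λ O → Star (Forces G) O ⊤)
      (⊆-antisym (λ _ → N⁺ ∈⊤ (inj₁ refl)) ⊆⊤) ε

    ⊥-notPDS : ¬ IsPDS G ⊥
    ⊥-notPDS pds = contradiction (absorb pds N⊥⊆⊥ stuck (∈⊤ {x = someVertex order nonEmpty})) ∉⊥
      where
      N⊥⊆⊥ : N[_] G ⊥ ⊆ ⊥
      N⊥⊆⊥ w∈N = contradiction (proj₁ (proj₂ (N⁻ w∈N))) ∉⊥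
      stuck : ¬ CanForce ⊥
      stuck (_ , _ , v∈⊥ , _) = ∉⊥ v∈⊥
      someVertex : ∀ n → NonZero n → Fin n
      someVertex (suc _) _ = zero

    allSubset? : ∀ {P : Pred (Subset order) 0ℓ} → Decidable P → Dec (∀ A → P A)
    allSubset? P? with anySubset? (λ A → ¬? (P? A))
    ... | yes (A , ¬PA) = no λ all → ¬PA (all A)
    ... | no ¬∃         = yes λ A → decidable-stable (P? A) λ ¬PA → ¬∃ (A , ¬PA)

  anyBelow? : ∀ {n} (b : Multiset n) {P : Pred (Multiset n) 0ℓ} →
              Decidable P → Dec (∃[ F ] F ⊑ b × P F)
  anyBelow? []      P? = map′ (λ p → [] , [] , p) (λ { ([] , [] , p) → p }) (P? [])
  anyBelow? (x ∷ b) P? = map′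
    (λ { (a , a<1+x , F , F⊑b , p) → a ∷ F , ℕ.≤-pred a<1+x ∷ F⊑b , p })
    (λ { (a ∷ F , a≤x ∷ F⊑b , p) → a , s≤s a≤x , F , F⊑b , p })
    (ℕ.anyUpTo? (λ a → anyBelow? b λ F → P? (a ∷ F)) (suc x))

  ⊑-card : ∀ {n} {m} (S : Multiset n) → card S ≤ m → S ⊑ replicate n m
  ⊑-card []      _  = []
  ⊑-card (x ∷ S) le =
    ℕ.≤-trans (ℕ.m≤m+n x _) le ∷ ⊑-card S (ℕ.≤-trans (ℕ.m≤n+m _ x) le)

  ⊤⊆support : ∀ {n} {k} (F : Multiset n) → card F ≤ k → ⊤ ⊆ support (replicate n (suc k) ∖ F)
  ⊤⊆support F le {x} _ = go F le x
    where
    positive : ∀ {a k} → a ≤ k → (0 <ᵇ (suc k ∸ a)) ≡ inside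
    positive {a} a≤k rewrite ℕ.+-∸-assoc 1 a≤k = refl
    go : ∀ {n k} (F : Multiset n) → card F ≤ k → ∀ x → x ∈ support (replicate n (suc k) ∖ F)
    go (a ∷ F) le zero = lookup⇒[]= zero _ (positive (ℕ.≤-trans (ℕ.m≤m+n a _) le))
    go {k = k} (a ∷ F) le (suc x) =
      lookup⇒[]= (suc x) _ ([]=⇒lookup (go F (ℕ.≤-trans (ℕ.m≤n+m _ a) le) x))

  k≤replicate : ∀ n {k} → NonZero n → k ≤ card (replicate n (suc k))
  k≤replicate (suc n) _ = ℕ.≤-trans (ℕ.n≤1+n _) (ℕ.m≤m+n _ _)

module _ (G : Graph) where
  open Graph G
  open Pow G

  abstract
    pdsOfSize? : Decidable (PDSOfSize G)
    pdsOfSize? m = anySubset? λ S → ∣ S ∣ ℕ.≟ m ×-dec isPDS? S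

    pds-exists : ∃ (PDSOfSize G)
    pds-exists = ∣ ⊤ {order} ∣ , ⊤ , refl , ⊤-isPDS

    isRobustPDS? : ∀ k → Decidable (IsRobustPDS G k)
    isRobustPDS? k S = k ℕ.≤? card S ×-dec robust?
      where
      Good : Pred (Multiset order) 0ℓ
      Good F = ∃[ D ] D ⊆ support (S ∖ F) × IsPDS G D
      good? : Decidable Good
      good? F = anySubset? λ D → D ⊆? support (S ∖ F) ×-dec isPDS? D
      robust? : Dec (∀ F → F ⊑ S → card F ≡ k → Good F)
      robust? with anyBelow? S (λ F → card F ℕ.≟ k ×-dec ¬? (good? F))
      ... | yes (F , F⊑S , ∣F∣≡k , bad) = no λ all → bad (all F F⊑S ∣F∣≡k)
      ... | no ¬∃ = yes λ F F⊑S ∣F∣≡k →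
        decidable-stable (good? F) λ bad → ¬∃ (F , F⊑S , ∣F∣≡k , bad)

    robustPDSOfSize? : ∀ k → Decidable (RobustPDSOfSize G k)
    robustPDSOfSize? k m = map′
      (λ { (S , _ , p) → S , p })
      (λ { (S , ∣S∣≡m , r) → S , ⊑-card S (ℕ.≤-reflexive ∣S∣≡m) , ∣S∣≡m , r })
      (anyBelow? (replicate order m) λ S → card S ℕ.≟ m ×-dec isRobustPDS? k S)

    robustPDS-exists : ∀ k → ∃ (RobustPDSOfSize G k)
    robustPDS-exists k = _ , replicate order (suc k) , refl , k≤replicate order nonEmpty ,
      λ F _ ∣F∣≡k → ⊤ , ⊤⊆support F (ℕ.≤-reflexive ∣F∣≡k) , ⊤-isPDS

    everySubsetPDSOfSize? : ∀ j → Decidable (EverySubsetPDSOfSize G j)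
    everySubsetPDSOfSize? j m = anySubset? λ B → ∣ B ∣ ℕ.≟ m ×-dec
      allSubset? λ A → A ⊆? B →-dec ∣ A ∣ ℕ.≟ j →-dec isPDS? A

    everySubsetPDS-bounded : ∀ j {m} → EverySubsetPDSOfSize G j m → m ≤ order
    everySubsetPDS-bounded j (B , refl , _) = ∣p∣≤n B

  minPDS : ∃ (IsLeast (PDSOfSize G))
  minPDS = least pdsOfSize? pds-exists

  γP : ℕ
  γP = proj₁ minPDS

  minRobustPDS : ∀ k → ∃ (IsLeast (RobustPDSOfSize G k))
  minRobustPDS k = least (robustPDSOfSize? k) (robustPDS-exists k)

  γ̈P : ℕ → ℕ
  γ̈P k = proj₁ (minRobustPDS k)

  abstract
    γP≥1 : γP ≥ 1
    γP≥1 with minPDS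
    ... | suc _ , _ = s≤s z≤n
    ... | zero , (S , ∣S∣≡0 , pds) , _ = contradiction (subst (IsPDS G) S≡⊥ pds) ⊥-notPDS
      where
      S≡⊥ : S ≡ ⊥
      S≡⊥ = Empty-unique λ { (x , x∈S) →
        ℕ.1+n≰n (subst (1 ≤_) ∣S∣≡0 (subst (_≤ ∣ S ∣) (∣⁅x⁆∣≡1 x)
          (p⊆q⇒∣p∣≤∣q∣ λ y∈x → subst (_∈ S) (sym (x∈⁅y⁆⇒x≡y x y∈x)) x∈S))) }

    everySubsetPDS-exists : ∀ {j} → j ≥ γP → ∃ (EverySubsetPDSOfSize G j)
    everySubsetPDS-exists j≥γP = _ , ⊥ , refl , λ A A⊆⊥ ∣A∣≡j →
      contradiction
        (ℕ.≤-trans γP≥1 (ℕ.≤-trans j≥γP (subst (_≤ ∣ ⊥ {order} ∣) ∣A∣≡j (p⊆q⇒∣p∣≤∣q∣ A⊆⊥))))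
        λ 1≤∣⊥∣ → ℕ.1+n≰n (subst (1 ≤_) (∣⊥∣≡0 order) 1≤∣⊥∣)

  -- A suitable set always exists for j ≥ γP: then j ≥ 1, so ⊥ has no subset of
  -- cardinality j and qualifies vacuously.
  maxEverySubsetPDS : ∀ {j} → j ≥ γP → ∃ (IsGreatest (EverySubsetPDSOfSize G j))
  maxEverySubsetPDS {j} j≥γP =
    greatest (everySubsetPDSOfSize? j) (everySubsetPDS-exists j≥γP) order
      (everySubsetPDS-bounded j)

  s : ∀ j → j ≥ γP → ℕ
  s j j≥γP = proj₁ (maxEverySubsetPDS j≥γP)

{-# OPTIONS --safe #-}
-- Take q copies of a largest set B all of whose j-subsets are power dominating, and,
-- if r > 0, one further copy of r + (j − 1) elements of B. With c the largest
-- multiplicity, deleting k PMUs leaves more than c (j − 1) of them, so by the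
-- pigeonhole principle they occupy at least j vertices of B.
module Submission where

open import Defs
open import Data.Nat using (ℕ; suc; _+_; _*_; _∸_; _/_; _≤_; _<_; _≥_; _>_)
open import Data.Product using (_×_)
open import Relation.Binary.PropositionalEquality using (_≡_)

open import Data.Bool.Base using (true; false; if_then_else_)
open import Data.Fin.Subset using (Subset; _⊆_; ∣_∣; ⊥; inside; outside)
open import Data.Fin.Subset.Properties using (⊥⊆; ∣⊥∣≡0; s⊆s; drop-∷-⊆; out⊆)
open import Data.Nat using (zero; z≤n; s≤s)
open import Data.Nat.Divisibility using (n∣m*n)
open import Data.Nat.DivMod using (+-distrib-/-∣ˡ; m*n/n≡m; m<n⇒m/n≡0)
open import Data.Nat.Properties
open import Data.Nat.Tactic.RingSolver using (solve-∀)
open import Data.Product using (_,_; proj₁; proj₂; ∃-syntax)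
open import Data.Vec.Base using ([]; _∷_; map; zipWith; here; there)
open import Data.Vec.Relation.Binary.Pointwise.Inductive as Pointwise using ([]; _∷_)
open import Function.Base using (_∘_)
open import Relation.Binary.PropositionalEquality using (refl; sym; trans; cong; cong₂; subst)
open import Relation.Nullary using (contradiction)

-- Also serves as an upper bound: `S ⊑ copies c B` says at once that `S` lives on `B` and that no
-- multiplicity exceeds `c`.
copies : ∀ {n} → ℕ → Subset n → Multiset n
copies c = map (if_then c else 0)

infixl 6 _⊎ᵐ_
_⊎ᵐ_ : ∀ {n} → Multiset n → Multiset n → Multiset n
_⊎ᵐ_ = zipWith _+_

⊑-refl : ∀ {n} {M : Multiset n} → M ⊑ M
⊑-refl = Pointwise.refl ≤-refl

⊑-trans : ∀ {n} {L M N : Multiset n} → L ⊑ M → M ⊑ N → L ⊑ N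
⊑-trans = Pointwise.trans ≤-trans

card-copies : ∀ {n} c (B : Subset n) → card (copies c B) ≡ c * ∣ B ∣
card-copies c []          = sym (*-zeroʳ c)
card-copies c (true ∷ B)  = trans (cong (c +_) (card-copies c B)) (sym (*-suc c ∣ B ∣))
card-copies c (false ∷ B) = card-copies c B

card-⊎ᵐ : ∀ {n} (M N : Multiset n) → card (M ⊎ᵐ N) ≡ card M + card N
card-⊎ᵐ []      []      = refl
card-⊎ᵐ (x ∷ M) (y ∷ N) =
  trans (cong (x + y +_) (card-⊎ᵐ M N)) (interchange x y (card M) (card N))
  where
  interchange : ∀ a b c d → a + b + (c + d) ≡ a + c + (b + d)
  interchange = solve-∀

∖-⊑ : ∀ {n} (M N : Multiset n) → M ∖ N ⊑ M
∖-⊑ []      []      = []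
∖-⊑ (x ∷ M) (y ∷ N) = m∸n≤m x y ∷ ∖-⊑ M N

∖-⊎ᵐ-cancel : ∀ {n} {F M : Multiset n} → F ⊑ M → (M ∖ F) ⊎ᵐ F ≡ M
∖-⊎ᵐ-cancel []          = refl
∖-⊎ᵐ-cancel (x≤y ∷ F⊑M) = cong₂ _∷_ (m∸n+n≡m x≤y) (∖-⊎ᵐ-cancel F⊑M)

-- A vertex outside `B` is also outside `A`, so the extra layer raises multiplicities by one on `B`
-- only.
copies-⊎ᵐ-⊑ : ∀ {n} c {A B : Subset n} → A ⊆ B → copies c B ⊎ᵐ copies 1 A ⊑ copies (suc c) B
copies-⊎ᵐ-⊑ c {[]}        {[]}        A⊆B = []
copies-⊎ᵐ-⊑ c {true ∷ _}  {true ∷ _}  A⊆B = ≤-reflexive (+-comm c 1) ∷ copies-⊎ᵐ-⊑ c (drop-∷-⊆ A⊆B)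
copies-⊎ᵐ-⊑ c {true ∷ _}  {false ∷ _} A⊆B with () ← A⊆B here
copies-⊎ᵐ-⊑ c {false ∷ _} {true ∷ _}  A⊆B =
  ≤-trans (≤-reflexive (+-identityʳ c)) (n≤1+n c) ∷ copies-⊎ᵐ-⊑ c (drop-∷-⊆ A⊆B)
copies-⊎ᵐ-⊑ c {false ∷ _} {false ∷ _} A⊆B = z≤n ∷ copies-⊎ᵐ-⊑ c (drop-∷-⊆ A⊆B)

-- Pigeonhole: each occupied vertex accounts for at most `c` PMUs.
card≤c*∣support∣ : ∀ {n c} {M : Multiset n} {B : Subset n} →
                   M ⊑ copies c B → card M ≤ c * ∣ support M ∣
card≤c*∣support∣ {M = []}         {[]}        []          = z≤n
card≤c*∣support∣ {M = zero ∷ _}   {_ ∷ _}     (_ ∷ M⊑)    = card≤c*∣support∣ M⊑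
card≤c*∣support∣ {c = c} {suc x ∷ M} {true ∷ _} (x<c ∷ M⊑) =
  ≤-trans (+-mono-≤ x<c (card≤c*∣support∣ M⊑)) (≤-reflexive (sym (*-suc c ∣ support M ∣)))
card≤c*∣support∣ {M = suc _ ∷ _}  {false ∷ _} (() ∷ _)

support⊆ : ∀ {n c} {M : Multiset n} {B : Subset n} → M ⊑ copies c B → support M ⊆ B
support⊆ {M = suc _ ∷ _} {true ∷ _}  _        here       = here
support⊆ {M = suc _ ∷ _} {false ∷ _} (() ∷ _) here
support⊆ {M = _ ∷ _}     {_ ∷ _}     (_ ∷ M⊑) (there x∈) = there (support⊆ M⊑ x∈)

subsetOfSize : ∀ {n} (B : Subset n) {m} → m ≤ ∣ B ∣ → ∃[ A ] A ⊆ B × ∣ A ∣ ≡ m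
subsetOfSize {n} B           {zero}  _ = ⊥ , ⊥⊆ , ∣⊥∣≡0 n
subsetOfSize     (true ∷ B)  {suc m} (s≤s m≤) with subsetOfSize B m≤
... | A , A⊆B , ∣A∣≡m = inside ∷ A , s⊆s A⊆B , cong suc ∣A∣≡m
subsetOfSize     (false ∷ B) {suc m} m≤ with subsetOfSize B m≤
... | A , A⊆B , ∣A∣≡m = outside ∷ A , out⊆ A⊆B , ∣A∣≡m

-- The robustness criterion shared by both cases, each of which only supplies `c` and the count
-- `large`. Here `j` is one less than the size of the power dominating subsets, which keeps
-- truncated subtraction out of the counting.
⊑copies⇒robust : ∀ G {k j c B S} → EverySubsetPDS G (suc j) B →
                 S ⊑ copies c B → c * j + k < card S → IsRobustPDS G k S
⊑copies⇒robust G {k} {j} {c} {B} {S} everyPDS S⊑ large =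
  ≤-trans (m≤n+m k (c * j)) (<⇒≤ large) , survives
  where
  survives : ∀ F → F ⊑ S → card F ≡ k → ∃[ D ] D ⊆ support (S ∖ F) × IsPDS G D
  survives F F⊑S refl = D , D⊆ , everyPDS D (support⊆ rest⊑ ∘ D⊆) ∣D∣≡
    where
    rest⊑ : S ∖ F ⊑ copies c B
    rest⊑ = ⊑-trans (∖-⊑ S F) S⊑
    card-rest : card S ≡ card (S ∖ F) + card F
    card-rest = trans (cong card (sym (∖-⊎ᵐ-cancel F⊑S))) (card-⊎ᵐ (S ∖ F) F)
    j<∣support∣ : j < ∣ support (S ∖ F) ∣
    -- Removing `card F` from both sides of `large` leaves more than `c * j` PMUs, hence
    -- `c * j < c * ∣ support (S ∖ F) ∣`. This is impossible at `c = 0`, so `c` can be cancelled.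
    j<∣support∣ = *-cancelˡ-< c _ _ (<-≤-trans
      (+-cancelʳ-< (card F) _ _ (<-≤-trans large (≤-reflexive card-rest)))
      (card≤c*∣support∣ rest⊑))
    chosen = subsetOfSize (support (S ∖ F)) j<∣support∣
    D = proj₁ chosen
    D⊆ = proj₁ (proj₂ chosen)
    ∣D∣≡ = proj₂ (proj₂ chosen)

γ̈P≤card : ∀ G {k S} → IsRobustPDS G k S → γ̈P G k ≤ card S
γ̈P≤card G {k} {S} robust = proj₂ (proj₂ (minRobustPDS G k)) (S , refl , robust)

-- In terms of the theorem, `j` is its `j` minus one and `m` is the divisor, so `∣B∣≡` splits the
-- maximum as `(j - 1) + (s - j + 1)`.
module _ (G : Graph) {k j m q : ℕ} {B : Subset (Graph.order G)}
         (∣B∣≡ : ∣ B ∣ ≡ j + m) (everyPDS : EverySubsetPDS G (suc j) B) where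

  γ̈P≤-r≡0 : k + 1 ≡ q * m → γ̈P G k ≤ ∣ B ∣ * q
  γ̈P≤-r≡0 eq = subst (γ̈P G k ≤_) (trans card≡ (*-comm q ∣ B ∣))
    (γ̈P≤card G (⊑copies⇒robust G everyPDS (⊑-refl {M = copies q B}) large))
    where
    open ≤-Reasoning
    card≡ : card (copies q B) ≡ q * ∣ B ∣
    card≡ = card-copies q B
    large : q * j + k < card (copies q B)
    -- The count is exact: `copies q B` has precisely one PMU more than the threshold `q * j + k`.
    large = ≤-reflexive (begin-equality
      suc (q * j + k)     ≡⟨ +-suc (q * j) k ⟨
      q * j + suc k       ≡⟨ cong (q * j +_) (+-comm 1 k) ⟩
      q * j + (k + 1)     ≡⟨ cong (q * j +_) eq ⟩
      q * j + q * m       ≡⟨ *-distribˡ-+ q j m ⟨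
      q * (j + m)         ≡⟨ cong (q *_) ∣B∣≡ ⟨
      q * ∣ B ∣           ≡⟨ card≡ ⟨
      card (copies q B)   ∎)

  γ̈P≤-r<m : ∀ {r} → k + 1 ≡ q * m + r → r < m → γ̈P G k ≤ ∣ B ∣ * q + r + j
  γ̈P≤-r<m {r} eq r<m
    -- The extra layer makes the largest multiplicity `suc q`, which raises the threshold by `j`;
    -- covering this and the remainder takes exactly `r + j` further PMUs. They fit into `B` because
    -- `r < m`.
    with subsetOfSize B {r + j} (≤-trans (+-monoˡ-≤ j (<⇒≤ r<m))
           (≤-reflexive (trans (+-comm m j) (sym ∣B∣≡))))
  ... | A , A⊆B , ∣A∣≡ = subst (γ̈P G k ≤_) card≡
    (γ̈P≤card G (⊑copies⇒robust G everyPDS (copies-⊎ᵐ-⊑ q A⊆B) large))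
    where
    open ≤-Reasoning
    S = copies q B ⊎ᵐ copies 1 A
    card≡ : card S ≡ ∣ B ∣ * q + r + j
    card≡ = begin-equality
      card S                                 ≡⟨ card-⊎ᵐ (copies q B) (copies 1 A) ⟩
      card (copies q B) + card (copies 1 A)  ≡⟨ cong₂ _+_ (card-copies q B) (card-copies 1 A) ⟩
      q * ∣ B ∣ + 1 * ∣ A ∣                  ≡⟨ cong₂ _+_ (*-comm q ∣ B ∣) (*-identityˡ ∣ A ∣) ⟩
      ∣ B ∣ * q + ∣ A ∣                      ≡⟨ cong (∣ B ∣ * q +_) ∣A∣≡ ⟩
      ∣ B ∣ * q + (r + j)                    ≡⟨ +-assoc (∣ B ∣ * q) r j ⟨
      ∣ B ∣ * q + r + j                      ∎
    collect : ∀ q j k → suc (suc q * j + k) ≡ suc q * j + (k + 1)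
    collect = solve-∀
    regroup : ∀ q j m r → suc q * j + (q * m + r) ≡ (j + m) * q + r + j
    regroup = solve-∀
    large : suc q * j + k < card S
    large = ≤-reflexive (begin-equality
      suc (suc q * j + k)        ≡⟨ collect q j k ⟩
      suc q * j + (k + 1)        ≡⟨ cong (suc q * j +_) eq ⟩
      suc q * j + (q * m + r)    ≡⟨ regroup q j m r ⟩
      (j + m) * q + r + j        ≡⟨ cong (λ b → b * q + r + j) ∣B∣≡ ⟨
      ∣ B ∣ * q + r + j          ≡⟨ card≡ ⟨
      card S                     ∎)

-- Identifies the floor in the stated bounds with the given `q`, in terms of which the two cases are
-- proved.
quotient-unique : ∀ {n d r} q → n ≡ q * suc d + r → r < suc d → n / suc d ≡ q
quotient-unique {d = d} {r} q refl r<d = begin-equality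
  (q * suc d + r) / suc d          ≡⟨ +-distrib-/-∣ˡ r (n∣m*n q) ⟩
  q * suc d / suc d + r / suc d    ≡⟨ cong₂ _+_ (m*n/n≡m q (suc d)) (m<n⇒m/n≡0 r<d) ⟩
  q + 0                            ≡⟨ +-identityʳ q ⟩
  q                                ∎
  where open ≤-Reasoning

theorem2 : (G : Graph) (k : ℕ) → k ≥ 1 →
    (j : ℕ) (j≥γP : j ≥ γP G) → s G j j≥γP > j →
    (q r : ℕ) →
    k + 1 ≡ q * suc (s G j j≥γP ∸ j) + r →
    r < suc (s G j j≥γP ∸ j) →
    (r ≡ 0 → γ̈P G k ≤ s G j j≥γP * ((k + 1) / suc (s G j j≥γP ∸ j))) ×
    (r > 0 → γ̈P G k ≤ s G j j≥γP * ((k + 1) / suc (s G j j≥γP ∸ j)) + r + (j ∸ 1))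
-- The empty set is never power dominating, so `j` is positive and `j ∸ 1` is a true predecessor.
theorem2 G k _ zero j≥γP _ q r eq r< = contradiction (≤-trans (γP≥1 G) j≥γP) λ ()
theorem2 G k _ (suc j) j≥γP s>j q r eq r<
  rewrite quotient-unique q eq r<
  -- `s` unfolds to the first component of this witness; matching its size proof with `refl` turns
  -- `s` into `∣ B ∣` throughout.
  with maxEverySubsetPDS G j≥γP
... | _ , (B , refl , everyPDS) , _ =
  (λ { refl → γ̈P≤-r≡0 G ∣B∣≡ everyPDS (trans eq (+-identityʳ _)) }) ,
  (λ _ → γ̈P≤-r<m G {q = q} ∣B∣≡ everyPDS eq r<)
  where
  ∣B∣≡ : ∣ B ∣ ≡ j + suc (∣ B ∣ ∸ suc j)
  -- `s>j` ensures that the subtraction is not truncated.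
  ∣B∣≡ = sym (trans (+-suc j _) (m+[n∸m]≡n (<⇒≤ s>j)))
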